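{- Let $U$ be a set, $\mathcal Y\subseteq\mathcal P(U)$ a family of subsets of $U$, and let $\eta,\rho:\mathcal Y\to\mathcal P(U)$ be functions. Then there is an attacking level 2 structure relative to $\eta$ representing $\rho$ if and only if both of the following hold: (1) $\rho(X)\subseteq\eta(X)$ for all $X\in\mathcal Y$; (2) $\rho(\emptyset)=\eta(\emptyset)$ if $\emptyset\in\mathcal Y$.
   Context: $\mathcal P$ is the power set operator. A generalized preferential structure $\mathcal X$ over a set $U$ consists of a set of points, which are pairs $\langle x,i\rangle$ ("copies" of $x$) with $x\in U$ and $i$ an index, and a set of arrows. Each arrow $\alpha$ has an origin, which is a point, and a destination, which is a point or another arrow; distinct arrows may have the same origin and destination (copies of arrows). Here every $x\in U$ has at least one copy. We write $\alpha:\langle x,i\rangle\to d$, or just $\alpha:x\to d$, when the origin is a copy of $x$ and the destination is $d$. Levels: an arrow whose destination is a point has level 1; an arrow whose destination is an arrow of level $n$ has level $n+1$. $\mathcal X$ is a level $n$ structure ($n\ge 1$ finite) iff every arrow has level at most $n$. For arrows define inductively: if $\alpha:\langle x,i\rangle\to\langle y,j\rangle$ has level 1, $O(\alpha)=\{x\}$ and $D(\alpha)=\{y\}$; if $\alpha:\langle x,i\rangle\to\beta$ with $\beta$ an arrow, $O(\alpha)=\{x\}\cup O(\beta)$ and $D(\alpha)=D(\beta)$. Validity (by downward induction on the level): for sets $X,Y\subseteq U$, an arrow $\alpha$ is a valid $X$-to-$Y$ arrow iff $O(\alpha)\subseteq X$, $D(\alpha)\subseteq Y$, and for every arrow $\beta:x'\to\alpha$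 with $x'\in X$ there is an arrow $\gamma:x''\to\beta$ which is a valid $X$-to-$Y$ arrow. $\mathcal X$ is called an attacking structure relative to $\eta$ representing $\rho$ iff for all $X\in\mathcal Y$: $\rho(X)$ is the set of all $x\in\eta(X)$ such that there is a copy $\langle x,i\rangle$ in $\mathcal X$ for which there is no valid $X$-to-$\eta(X)$ arrow $\alpha:\langle x',i'\rangle\to\langle x,i\rangle$. An "attacking level 2 structure" is an attacking structure which is a level 2 structure. -}

module Defs where

open import Level using (Level; _⊔_; suc)
open import Data.Nat using (ℕ; _≤_) renaming (suc to 1+_)
open import Data.Product using (Σ; ∃; _×_; _,_; proj₁)
open import Data.Sum using (_⊎_; inj₁; inj₂)
open import Function.Bundles using (Func; _⟨$⟩_)
open import Relation.Binary.Bundles using (Setoid)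
open import Relation.Binary.PropositionalEquality using (_≡_)
open import Relation.Nullary using (¬_)
open import Relation.Unary using (Pred; _∈_; _⊆_; _≐_)
open import Relation.Unary.Relation.Binary.Equality using (≐-setoid)
import Relation.Binary.Construct.On as On

𝒫 : ∀ {a} → Set a → Set (suc a)
𝒫 {a} A = Pred A a

-- Subsets are identified when they have the same elements (_≐_), so a function
-- 𝒴 → 𝒫 U is a map of setoids: it does not depend on the predicate by which a
-- member of 𝒴 is presented, nor on the proof that it is a member.
_⟶𝒫_ : ∀ {u} {U : Set u} → 𝒫 (𝒫 U) → (V : Set u) → Set (suc u)
_⟶𝒫_ {u} {U} 𝒴 V =
  Func (On.setoid (≐-setoid U u) (proj₁ {B = 𝒴})) (≐-setoid V u)

-- A set of pairs ⟨x , i⟩ is given by, for each x, the type of indices i for which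
-- ⟨x , i⟩ is a point.  Arrows are a type of their own, so that distinct arrows may
-- share origin and destination.
record Structure {u} (ℓ : Level) (U : Set u) : Set (u ⊔ suc ℓ) where
  field
    Index : U → Set ℓ
    copy  : ∀ x → Index x

  Point : Set (u ⊔ ℓ)
  Point = Σ U Index

  field
    Arrow       : Set ℓ
    origin      : Arrow → Point
    destination : Arrow → Point ⊎ Arrow

  source : Arrow → U
  source α = proj₁ (origin α)

  data HasLevel (α : Arrow) : ℕ → Set (u ⊔ ℓ) where
    to-point : ∀ {p} → destination α ≡ inj₁ p → HasLevel α 1
    to-arrow : ∀ {β n} → destination α ≡ inj₂ β → HasLevel β n → HasLevel α (1+ n)

  -- In particular every arrow has a level, which excludes cycles and infinite
  -- chains of arrows attacking arrows.
  IsLevel : ℕ → Set (u ⊔ ℓ)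
  IsLevel n = ∀ α → ∃ λ m → HasLevel α m × m ≤ n

  data O (α : Arrow) : Pred U (u ⊔ ℓ) where
    here  : source α ∈ O α
    there : ∀ {β x} → destination α ≡ inj₂ β → x ∈ O β → x ∈ O α

  data D (α : Arrow) : Pred U (u ⊔ ℓ) where
    here  : ∀ {y j} → destination α ≡ inj₁ (y , j) → y ∈ D α
    there : ∀ {β y} → destination α ≡ inj₂ β → y ∈ D β → y ∈ D α

  -- In a level n structure chains of attacks have bounded length, so the defining
  -- clause has exactly one solution: this least one agrees with the one obtained
  -- by downward induction on the level.
  data Valid (X Y : 𝒫 U) (α : Arrow) : Set (u ⊔ ℓ) where
    valid : O α ⊆ X → D α ⊆ Y →
            (∀ β → destination β ≡ inj₂ α → source β ∈ X →
              ∃ λ γ → destination γ ≡ inj₂ β × Valid X Y γ) →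
            Valid X Y α

  IsAttacking : {𝒴 : 𝒫 (𝒫 U)} (η ρ : 𝒴 ⟶𝒫 U) → Set (suc u ⊔ ℓ)
  IsAttacking {𝒴} η ρ = ∀ (X : 𝒫 U) (X∈𝒴 : X ∈ 𝒴) →
    let ηX = η ⟨$⟩ (X , X∈𝒴) in
    (ρ ⟨$⟩ (X , X∈𝒴)) ≐
      λ x → x ∈ ηX ×
            ∃ λ (i : Index x) →
              ¬ ∃ λ α → destination α ≡ inj₁ (x , i) × Valid X ηX α

open Structure public using (IsLevel; IsAttacking)

{-# OPTIONS --safe #-}
-- In a level 2 structure an arrow α : y → x is a valid X-to-η(X) arrow iff y ∈ X,
-- x ∈ η(X) and no attacker of α starts in X.  Hence nothing is valid for X = ∅,
-- which gives (2).
--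
-- Conversely, say that X deletes x if x ∈ η(X) ∖ ρ(X).  Take one copy of x for
-- every W that does not delete x; ∅ is such a W by (2).  For every X deleting x,
-- attack the copy W from all y ∈ X ∖ W if W ⊆ X, and from all y ∈ X otherwise, and
-- attack these arrows from all points outside X.  Then the copy W has a Z-valid
-- attack iff Z meets the sources for some X ⊇ Z deleting x.  If Z deletes x, X = Z
-- always works, because the sources for Z are not empty.  If Z does not, the copy
-- Z survives, because the sources for every X ⊇ Z avoid Z.
module Submission where

open import Defs
open import Level using (Lift; lift; lower; suc)
open import Axiom.ExcludedMiddle using (ExcludedMiddle)
open import Data.Empty using (⊥-elim)
open import Data.Nat using (s≤s; z≤n)
open import Data.Product using (Σ; ∃; _×_; _,_; proj₁; proj₂)
open import Data.Sum using (inj₁; inj₂)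
open import Function.Base using (case_of_; id)
open import Function.Bundles using (Func; _⇔_; _⟨$⟩_; mk⇔)
open import Relation.Binary.Definitions using (_Respects_)
open import Relation.Binary.PropositionalEquality using (_≡_; refl)
open import Relation.Nullary using (¬_)
open import Relation.Nullary.Decidable using (map′; decidable-stable)
open import Relation.Unary using (_∈_; _∉_; _⊆_; _≐_)
open import Relation.Unary.Polymorphic using (∅)

lowerEM : ∀ {u} → ExcludedMiddle (suc u) → ExcludedMiddle u
lowerEM {u} em {P} = map′ lower lift (em {Lift (suc u) P})

module _ {u ℓ} {U : Set u} (𝒳 : Structure ℓ U) where
  open Structure 𝒳 hiding (IsAttacking)

  source-∈ : ∀ {X Y α} → Valid X Y α → source α ∈ X
  source-∈ (valid O⊆X _ _) = O⊆X here

  representable⇒⊆ : ∀ {𝒴} {η ρ : 𝒴 ⟶𝒫 U} → IsAttacking 𝒳 η ρ →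
    ∀ X (X∈𝒴 : X ∈ 𝒴) → (ρ ⟨$⟩ (X , X∈𝒴)) ⊆ (η ⟨$⟩ (X , X∈𝒴))
  representable⇒⊆ attacking X X∈𝒴 x∈ρX = proj₁ (proj₁ (attacking X X∈𝒴) x∈ρX)

  representable⇒∅ : ∀ {𝒴} {η ρ : 𝒴 ⟶𝒫 U} → IsAttacking 𝒳 η ρ →
    ∀ (∅∈𝒴 : ∅ ∈ 𝒴) → (ρ ⟨$⟩ (∅ , ∅∈𝒴)) ≐ (η ⟨$⟩ (∅ , ∅∈𝒴))
  representable⇒∅ {η = η} {ρ} attacking ∅∈𝒴 =
    representable⇒⊆ {η = η} {ρ} attacking ∅ ∅∈𝒴 ,
    λ {x} x∈η∅ → proj₂ (attacking ∅ ∅∈𝒴)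
      (x∈η∅ , copy x , λ (α , _ , α-valid) → ⊥-elim (lower (source-∈ α-valid)))

module Construction {u} {U : Set u} {𝒴 : 𝒫 (𝒫 U)} (𝒴-resp : 𝒴 Respects _≐_)
  (η ρ : 𝒴 ⟶𝒫 U)
  (η∅⊆ρ∅ : ∀ (∅∈𝒴 : ∅ ∈ 𝒴) → (η ⟨$⟩ (∅ , ∅∈𝒴)) ⊆ (ρ ⟨$⟩ (∅ , ∅∈𝒴))) where

  Deletes : 𝒫 U → U → Set (suc u)
  Deletes X x = Σ (X ∈ 𝒴) λ X∈𝒴 → x ∈ (η ⟨$⟩ (X , X∈𝒴)) × x ∉ (ρ ⟨$⟩ (X , X∈𝒴))

  deletes-resp : ∀ {x} → (λ X → Deletes X x) Respects _≐_
  deletes-resp {x} {X} {Y} X≐Y@(X⊆Y , Y⊆X) (X∈𝒴 , x∈ηX , x∉ρX) =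
    Y∈𝒴 ,
    proj₁ (Func.cong η {X , X∈𝒴} {Y , Y∈𝒴} X≐Y) x∈ηX ,
    λ x∈ρY → x∉ρX (proj₁ (Func.cong ρ {Y , Y∈𝒴} {X , X∈𝒴} (Y⊆X , X⊆Y)) x∈ρY)
    where Y∈𝒴 = 𝒴-resp X≐Y X∈𝒴

  ¬∅-deletes : ∀ x → ¬ Deletes ∅ x
  ¬∅-deletes x (∅∈𝒴 , x∈η∅ , x∉ρ∅) = x∉ρ∅ (η∅⊆ρ∅ ∅∈𝒴 x∈η∅)

  -- `Deletes` carries its own membership proof; congruence of `ρ` along the identity reconciles it
  -- with the given one.
  ∈ρ⇒¬deletes : ∀ {X x} (X∈𝒴 : X ∈ 𝒴) → x ∈ (ρ ⟨$⟩ (X , X∈𝒴)) → ¬ Deletes X x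
  ∈ρ⇒¬deletes {X} X∈𝒴 x∈ρX (X∈𝒴′ , _ , x∉ρX) =
    x∉ρX (proj₁ (Func.cong ρ {X , X∈𝒴} {X , X∈𝒴′} (id , id)) x∈ρX)

  -- `W` ranges over all subsets, not only members of `𝒴`, so that `∅` is always available.
  Index : U → Set (suc u)
  Index x = Σ (𝒫 U) λ W → ¬ Deletes W x

  copy : ∀ x → Index x
  copy x = ∅ , ¬∅-deletes x

  -- Both cases in one formula: `X` minus `W` if `W ⊆ X`, all of `X` otherwise.
  Source : (W X : 𝒫 U) → 𝒫 U
  Source W X y = y ∈ X × ¬ (y ∈ W × W ⊆ X)

  record Attack : Set (suc u) where
    constructor attackOn
    field
      {target}  : U
      index     : Index target
      {deleter} : 𝒫 U
      deletes   : Deletes deleter target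
      {start}   : U
      isSource  : start ∈ Source (proj₁ index) deleter
  open Attack

  data Arrow : Set (suc u) where
    attack  : Attack → Arrow
    counter : (a : Attack) (w : U) → w ∉ deleter a → Arrow

  structure : Structure (suc u) U
  structure = record
    { Index       = Index
    ; copy        = copy
    ; Arrow       = Arrow
    ; origin      = λ where
        -- Validity sees only the source of an arrow, so any copy can serve as origin.
        (attack a)      → start a , copy (start a)
        (counter a w _) → w , copy w
    ; destination = λ where
        (attack a)      → inj₁ (target a , index a)
        (counter a _ _) → inj₂ (attack a)
    }
  open Structure structure using (destination; Valid; valid; to-point; to-arrow; here; there)

  isLevel2 : IsLevel structure 2
  isLevel2 (attack a)      = 1 , to-point refl , s≤s z≤n
  isLevel2 (counter a _ _) = 2 , to-arrow refl (to-point refl) , s≤s (s≤s z≤n)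

  -- Every counter to `a` starts outside `deleter a`, so none has to be answered.
  attack-valid : ∀ (a : Attack) {Y} → target a ∈ Y → Valid (deleter a) Y (attack a)
  attack-valid a target∈Y = valid
    (λ { here → proj₁ (isSource a) ; (there () _) })
    (λ { (here refl) → target∈Y ; (there () _) })
    (λ { (attack _) () ; (counter _ _ w∉X) refl w∈X → ⊥-elim (w∉X w∈X) })

  module _ (em : ExcludedMiddle (suc u)) where
    private
      em₀ : ExcludedMiddle u
      em₀ = lowerEM em

    -- A point of `Z` outside `deleter a` would start a counter, and no arrow attacks a counter.
    valid-attack⇒⊆ : ∀ {Z Y} (a : Attack) → Valid Z Y (attack a) → Z ⊆ deleter a
    valid-attack⇒⊆ a (valid _ _ countered) {w} w∈Z = decidable-stable em₀ λ w∉X →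
      case countered (counter a w w∉X) refl w∈Z of λ where
        (attack _ , () , _)
        (counter _ _ _ , () , _)

    survives : ∀ {Z x Y} (¬del : ¬ Deletes Z x) →
      ¬ ∃ λ α → destination α ≡ inj₁ (x , Z , ¬del) × Valid Z Y α
    survives ¬del (attack a , refl , α-valid) =
      proj₂ (isSource a) (source-∈ structure α-valid , valid-attack⇒⊆ a α-valid)

    -- Without sources `Z ⊆ W`. Then `W ⊆ Z` fails, as `W` and `Z` would be equal but only `Z`
    -- deletes `x`. So every point of `Z` is a source, `Z` is empty, and `∅` deletes nothing.
    source-exists : ∀ {x W Z} → ¬ Deletes W x → Deletes Z x → ∃ (Source W Z)
    source-exists {x} {W} {Z} ¬del del = decidable-stable em₀ λ none →
      let
        Z⊆W : Z ⊆ W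
        Z⊆W y∈Z = decidable-stable em₀ λ y∉W → none (_ , y∈Z , λ (y∈W , _) → y∉W y∈W)

        W⊈Z : ¬ (W ⊆ Z)
        W⊈Z W⊆Z = ¬del (deletes-resp (Z⊆W , W⊆Z) del)

        Z⊆∅ : Z ⊆ ∅
        Z⊆∅ y∈Z = ⊥-elim (none (_ , y∈Z , λ (_ , W⊆Z) → W⊈Z W⊆Z))
      in ¬∅-deletes x (deletes-resp (Z⊆∅ , λ ()) del)

    isAttacking : (∀ X (X∈𝒴 : X ∈ 𝒴) → (ρ ⟨$⟩ (X , X∈𝒴)) ⊆ (η ⟨$⟩ (X , X∈𝒴))) →
      IsAttacking structure η ρ
    isAttacking ρ⊆η X X∈𝒴 =
      (λ x∈ρX → ρ⊆η X X∈𝒴 x∈ρX ,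
        -- The surviving copy is the one indexed by `X` itself.
        (X , ∈ρ⇒¬deletes X∈𝒴 x∈ρX) , survives (∈ρ⇒¬deletes X∈𝒴 x∈ρX)) ,
      (λ (x∈ηX , i , unattacked) → decidable-stable em₀ λ x∉ρX →
        -- If `X` deletes `x`, every copy `i` is hit by an attack whose deleter is `X` itself.
        let del = X∈𝒴 , x∈ηX , x∉ρX
            a   = attackOn i del (proj₂ (source-exists (proj₂ i) del))
        in unattacked (attack a , refl , attack-valid a x∈ηX))

proposition3p7 : ∀ {u} → ExcludedMiddle (suc u) →
    (U : Set u) (𝒴 : 𝒫 (𝒫 U)) → 𝒴 Respects _≐_ →
    (η ρ : 𝒴 ⟶𝒫 U) →
    (∃ λ (𝒳 : Structure (suc u) U) → IsLevel 𝒳 2 × IsAttacking 𝒳 η ρ)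
    ⇔
    ((∀ X (X∈𝒴 : X ∈ 𝒴) → (ρ ⟨$⟩ (X , X∈𝒴)) ⊆ (η ⟨$⟩ (X , X∈𝒴)))
     × (∀ (∅∈𝒴 : ∅ ∈ 𝒴) → (ρ ⟨$⟩ (∅ , ∅∈𝒴)) ≐ (η ⟨$⟩ (∅ , ∅∈𝒴))))
proposition3p7 em U 𝒴 𝒴-resp η ρ = mk⇔
  (λ (𝒳 , _ , attacking) →
    representable⇒⊆ 𝒳 {η = η} {ρ} attacking , representable⇒∅ 𝒳 {η = η} {ρ} attacking)
  (λ (ρ⊆η , ρ∅≐η∅) →
    let open Construction 𝒴-resp η ρ (λ ∅∈𝒴 → proj₂ (ρ∅≐η∅ ∅∈𝒴))
    in structure , isLevel2 , isAttacking em ρ⊆η)
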